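{- Let $n\ge1$ and $1\le p\le n$. A permutation $\pi\in S_n$ lies in $\bigcap_{r=1}^{n+1}\mathcal{T}_n^{(r,p)}$ if and only if $p+i-n\le \pi^{ -1}_i\le p+i-1$ for all $1\le i\le n$. Moreover, the number of such permutations is $C_{p,n-p}$.
   Context: Sites $L_n=\{0,\dots,n+1\}$. For $\pi\in S_n$, $r\in[n+1]$, $1\le p\le n$, the configuration $\pi^{(r,p)}$ places on site $i$ ($1\le i\le n$) the chip $\pi_i$ if $\pi_i<r$ and $\pi_i+1$ otherwise, and places an extra chip $r$ on site $p$. Toppling: while some site has at least two chips, pick such a site $i$, pick two chips $\alpha<\beta$ there, move $\alpha$ to $i-1$ and $\beta$ to $i+1$. The final configuration is independent of choices, with one chip on each site but one; reading left to right gives a permutation of $[n+1]$. $\mathcal{T}_n^{(r,p)}$ is the set of $\pi\in S_n$ for which this final permutation from $\pi^{(r,p)}$ is the identity. Poly-Bernoulli numbers of type C: $\sum_{n\ge0}C_{n,k}\frac{x^n}{n!}=\frac{\mathrm{Li}_{ -k}(1-e^{ -x})}{e^x-1}$ with $\mathrm{Li}_s(z)=\sum_{i\ge1}z^i/i^s$; equivalently $C_{n,k}=\sum_{m=0}^{\min(n,k)}(m!)^2\left\{{n+1\atop m+1}\right\}\left\{{k\atop m}\right\}$.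
   Formalization: C_{n,k} is taken to be the sum of (m!)^2 {n+1, m+1}{k, m} over 0≤m≤min(n,k); the generating function also given for it has n and k interchanged, and with it the count fails (n=3, p=2: 3 permutations, but it gives C_{2,1}=1). -}

module Defs where

open import Data.Nat using (ℕ; zero; suc; _+_; _*_; _∸_; _≤_; _<_; _<ᵇ_; _≡ᵇ_; _!)
open import Data.Bool using (if_then_else_)
open import Data.Fin using (Fin; zero; suc; toℕ; inject₁; _≟_)
open import Data.Fin.Permutation using (Permutation′; _⟨$⟩ʳ_; _⟨$⟩ˡ_; _≈_)
open import Data.List using (List; []; _∷_; _++_; length; concatMap; allFin; applyUpTo; map; upTo)
open import Data.Nat.ListAction using (sum)
open import Data.List.Membership.Propositional using (_∈_)
open import Data.List.Relation.Unary.All using (All)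
open import Data.List.Relation.Unary.AllPairs using (AllPairs)
open import Data.List.Relation.Binary.Permutation.Propositional using (_↭_)
open import Data.Product using (Σ; ∃; _×_)
open import Relation.Nullary using (¬_; yes; no)
open import Relation.Nullary.Decidable using (isYes)
open import Relation.Binary.PropositionalEquality using (_≡_)
open import Relation.Binary.Construct.Closure.ReflexiveTransitive using (Star)

S2 : ℕ → ℕ → ℕ
S2 zero    zero    = 1
S2 zero    (suc k) = 0
S2 (suc n) zero    = 0
S2 (suc n) (suc k) = suc k * S2 n (suc k) + S2 n k

min : ℕ → ℕ → ℕ
min zero    _       = zero
min (suc n) zero    = zero
min (suc n) (suc k) = suc (min n k)

polyBernoulliC : ℕ → ℕ → ℕ
polyBernoulliC n k =
  sum (map (λ m → (m !) * (m !) * S2 (suc n) (suc m) * S2 k m)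
           (upTo (suc (min n k))))

-- Chip configurations on the sites L_n = {0,…,n+1}.
-- A configuration assigns to each site the multiset (list, up to ↭)
-- of chip labels on it.

Config : ℕ → Set
Config n = Fin (suc (suc n)) → List ℕ

update : ∀ {m} {A : Set} → (Fin m → A) → Fin m → A → Fin m → A
update f s a t with s ≟ t
... | yes _ = a
... | no  _ = f t

-- interior site i : Fin n is site (toℕ i + 1); its neighbours
leftSite midSite rightSite : ∀ {n} → Fin n → Fin (suc (suc n))
leftSite  i = inject₁ (inject₁ i)
midSite   i = suc (inject₁ i)
rightSite i = suc (suc i)

data Topple {n : ℕ} (c : Config n) : Config n → Set where
  topple : (i : Fin n) (α β : ℕ) (rest : List ℕ) → α < β →
           c (midSite i) ↭ (α ∷ β ∷ rest) →
           Topple c (update (update (update c (midSite i) rest)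
                                    (leftSite i) (α ∷ c (leftSite i)))
                            (rightSite i) (β ∷ c (rightSite i)))

Stable : ∀ {n} → Config n → Set
Stable {n} c = ∀ s → length (c s) ≤ 1

reading : ∀ {n} → Config n → List ℕ
reading {n} c = concatMap c (allFin (suc (suc n)))

identityWord : ℕ → List ℕ
identityWord n = applyUpTo suc (suc n)

chipOf : ℕ → ℕ → ℕ
chipOf r v = if v <ᵇ r then v else suc v

permVal : ∀ {n} → Permutation′ n → Fin n → ℕ
permVal π i = suc (toℕ (π ⟨$⟩ʳ i))

initConfig : ∀ {n} → Permutation′ n → (r p : ℕ) → Config n
initConfig {n} π r p s =
  concatMap (λ i → if isYes (midSite i ≟ s) then chipOf r (permVal π i) ∷ [] else [])
            (allFin n)
  ++ (if toℕ s ≡ᵇ p then r ∷ [] else [])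

InT : (n : ℕ) → (r p : ℕ) → Permutation′ n → Set
InT n r p π =
  Σ (Config n) λ c → Star Topple (initConfig π r p) c × Stable c × reading c ≡ identityWord n

InAllT : (n p : ℕ) → Permutation′ n → Set
InAllT n p π = ∀ r → 1 ≤ r → r ≤ suc n → InT n r p π

-- p + i − n ≤ π⁻¹_i ≤ p + i − 1 for all 1 ≤ i ≤ n (indices 1-based;
-- written without truncated subtraction)
Window : (n p : ℕ) → Permutation′ n → Set
Window n p π = ∀ (i : Fin n) →
  let i′ = suc (toℕ i) ; inv = suc (toℕ (π ⟨$⟩ˡ i)) in
  (p + i′ ≤ inv + n) × (inv + 1 ≤ p + i′)

HasCount : ∀ {n} → (Permutation′ n → Set) → ℕ → Set
HasCount {n} P k = Σ (List (Permutation′ n)) λ L →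
  All P L × (∀ π → P π → ∃ λ σ → σ ∈ L × π ≈ σ) ×
  AllPairs (λ π σ → ¬ (π ≈ σ)) L × length L ≡ k

{-# OPTIONS --safe #-}
module Submission where

-- Toppling is a rewriting of words. A word of n+1 letters V x and H x puts the chip of its k-th
-- letter (k ≥ 0) on site k+1 if the letter is a V and on site k if it is an H. Then π^(r,p) is
-- the word V π₁ … V πₚ H r H πₚ₊₁ … H πₙ (chips renumbered), and a toppling rewrites V x H y to
-- H (min x y) V (max x y). Because min x y < max x y, the condition "every chip v has at most
-- n+1−v letters V after it and fewer than v letters H before it" holds after a rewriting step if
-- and only if it holds before. Every word with increasing chips satisfies it, and a normal form
-- H … H V … V with distinct chips that satisfies it is increasing. On the initial words of all
-- the π^(r,p), 1 ≤ r ≤ n+1, the condition is the window condition.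
--
-- For the count put q = n − p and let row i take the column π⁻¹ i. The first q rows (top) may use
-- all of the first p columns (left) and a strict staircase of the last q (right); the last p rows
-- (bottom) may use all right columns and a staircase of the left ones. Fill the bottom rows from
-- the last to the first, each taking an open left column or being deferred to the right columns:
-- leaving m rows deferred, and so m left columns open, is possible in S(p+1,m+1) ways. Then fill
-- the top rows from the first to the last: each takes one of the m open columns and opens a new
-- right column in its place, and all left columns get used in m! S(q,m) ways. The m deferred rows
-- fill the m open right columns in m! ways.

open import Defs
open import Data.Bool using (if_then_else_; true; false)
open import Data.Empty using (⊥-elim)
open import Data.Fin using (Fin; zero; suc; toℕ; fromℕ<; inject₁; _≟_)
open import Data.Fin.Permutation
  using (Permutation′; _⟨$⟩ʳ_; _⟨$⟩ˡ_; inverseˡ; inverseʳ; _≈_; permutation)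
open import Data.Fin.Properties using (toℕ-inject₁; toℕ-fromℕ<; toℕ-injective; toℕ<n)
open import Data.List
  using (List; []; _∷_; _++_; length; map; concat; concatMap; tabulate; allFin; applyUpTo; take; drop)
open import Data.List.Membership.Propositional using (_∈_; _∉_)
open import Data.List.Membership.Propositional.Properties
  using (∈-++⁻; ∈-++⁺ˡ; ∈-++⁺ʳ; ∈-map⁺; ∈-map⁻; ∈-∃++)
open import Data.List.Properties
  using (∷-injective; ++-identityʳ; ++-assoc; map-++; length-map; length-++; length-take;
         length-tabulate; map-tabulate; tabulate-cong; concatMap-cong; take++drop≡id; map-upTo)
open import Data.List.Relation.Binary.Permutation.Propositional
  using (_↭_; ↭-refl; ↭-reflexive; ↭-sym; ↭-trans; prep; ↭-swap; ↭⇒↭ₛ)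
open import Data.List.Relation.Binary.Permutation.Propositional.Properties
  using (All-resp-↭; ↭-empty-inv; ↭-singleton-inv; ¬x∷xs↭[]; ↭-length; ++⁺ˡ; ++⁺ʳ; ++-comm; shift; ∈-resp-↭)
import Data.List.Relation.Binary.Permutation.Setoid.Properties as ↭ₛ
import Data.List.Relation.Unary.All as All
open import Data.List.Relation.Unary.All using (All; []; _∷_)
import Data.List.Relation.Unary.All.Properties as All
open import Data.List.Relation.Unary.AllPairs using ([]; _∷_)
import Data.List.Relation.Unary.AllPairs.Properties as AllPairs
open import Data.List.Relation.Unary.Any using (here; there)
open import Data.List.Relation.Unary.Unique.Propositional using (Unique)
import Data.List.Relation.Unary.Unique.Propositional.Properties as Unique
open import Data.Nat
  using (ℕ; zero; suc; pred; _+_; _*_; _∸_; _⊓_; _!; _≤_; _<_; z≤n; s≤s; s≤s⁻¹; _≤?_; _<?_; _<ᵇ_; _≡ᵇ_)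
open import Data.Nat.ListAction using (sum)
open import Data.Nat.Properties hiding (_≟_)
open import Data.Nat.Tactic.RingSolver using (solve-∀)
open import Data.Product using (_×_; _,_; proj₁; proj₂; ∃; ∃₂)
open import Data.Sum using (_⊎_; inj₁; inj₂)
open import Data.Unit using (⊤; tt)
open import Function using (_∘_)
open import Function.Bundles using (_⇔_; mk⇔; module Equivalence)
open import Relation.Binary using (tri<; tri≈; tri>)
open import Relation.Binary.Construct.Closure.ReflexiveTransitive using (Star; ε; _◅_; _◅◅_; gmap)
open import Relation.Binary.PropositionalEquality
  using (_≡_; _≢_; refl; sym; trans; cong; cong₂; subst; subst₂; setoid; module ≡-Reasoning)
open import Relation.Nullary using (¬_; yes; no; contradiction)
open import Relation.Nullary.Decidable using (isYes)

-- Words and sites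

data Edge : Set where
  V H : ℕ → Edge

label : Edge → ℕ
label (V x) = x
label (H x) = x

before after : Edge → List ℕ
before (V _) = []
before (H y) = y ∷ []
after (V x) = x ∷ []
after (H _) = []

-- The first argument is the content carried over to site 0 from a letter to the left of the word.
site : List ℕ → List Edge → ℕ → List ℕ
site cs []      zero    = cs
site cs []      (suc k) = []
site cs (e ∷ w) zero    = cs ++ before e
site cs (e ∷ w) (suc k) = site (after e) w k

-- Site `k + 1` topples, `α` goes to site `k` and `β` to site `k + 2`. The `↭` premise covers both
-- orders of `x` and `y` with one constructor.
data Step : ℕ → ℕ → ℕ → List Edge → List Edge → Set where
  here  : ∀ {x y α β w} → α < β → x ∷ y ∷ [] ↭ α ∷ β ∷ [] →
          Step 0 α β (V x ∷ H y ∷ w) (H α ∷ V β ∷ w)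
  there : ∀ {e k α β w w′} → Step k α β w w′ → Step (suc k) α β (e ∷ w) (e ∷ w′)

_⟶_ : List Edge → List Edge → Set
w ⟶ w′ = ∃ λ k → ∃₂ λ α β → Step k α β w w′

module _ {α β : ℕ} where

  step-left : ∀ {cs k w w′} → Step k α β w w′ → site cs w′ k ↭ α ∷ site cs w k
  step-left {cs} (here {w = w} _ _) =
    ↭-trans (++-comm cs (α ∷ [])) (prep α (↭-reflexive (sym (++-identityʳ cs))))
  step-left (there st) = step-left st

  step-mid : ∀ {cs k w w′} → Step k α β w w′ → site cs w (suc k) ↭ α ∷ β ∷ []
  step-mid (here _ xy) = xy
  step-mid (there st) = step-mid st

  step-mid′ : ∀ {cs k w w′} → Step k α β w w′ → site cs w′ (suc k) ≡ []
  step-mid′ (here _ xy) = refl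
  step-mid′ (there st) = step-mid′ st

  step-right : ∀ {cs k w w′} → Step k α β w w′ → site cs w′ (2 + k) ≡ β ∷ site cs w (2 + k)
  step-right (here {w = []} _ _) = refl
  step-right (here {w = e ∷ w} _ _) = refl
  step-right (there st) = step-right st

  step-other : ∀ {cs k w w′} → Step k α β w w′ → ∀ j → j ≢ k → j ≢ 1 + k → j ≢ 2 + k →
               site cs w′ j ≡ site cs w j
  step-other (here _ _) 0 a b c = ⊥-elim (a refl)
  step-other (here _ _) 1 a b c = ⊥-elim (b refl)
  step-other (here _ _) 2 a b c = ⊥-elim (c refl)
  step-other (here {w = []} _ _) (suc (suc (suc j))) a b c = refl
  step-other (here {w = e ∷ w} _ _) (suc (suc (suc j))) a b c = refl
  step-other (there st) zero a b c = refl
  step-other (there st) (suc j) a b c =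
    step-other st j (a ∘ cong suc) (b ∘ cong suc) (c ∘ cong suc)

  step-length : ∀ {k w w′} → Step k α β w w′ → length w′ ≡ length w
  step-length (here _ _) = refl
  step-length (there st) = cong suc (step-length st)

  step-index : ∀ {k w w′} → Step k α β w w′ → suc k < length w
  step-index (here _ _) = s≤s (s≤s z≤n)
  step-index (there st) = s≤s (step-index st)

  step-< : ∀ {k w w′} → Step k α β w w′ → α < β
  step-< (here lt _) = lt
  step-< (there st) = step-< st

  step-chips : ∀ {k w w′} → Step k α β w w′ → map label w ↭ map label w′
  step-chips (here _ xy) = ++⁺ʳ _ xy
  step-chips (there st) = prep _ (step-chips st)

  -- A site between two letters holds the chip of the left one only if that is a `V`, and of the
  -- right one only if that is an `H`. Two chips therefore force the pattern `V x`, `H y` and leave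
  -- no room for a third.
  step-exists : ∀ {cs} k w {rest} → α < β → site cs w (suc k) ↭ α ∷ β ∷ rest →
                (∃ λ w′ → Step k α β w w′) × rest ≡ []
  step-exists k [] lt p = ⊥-elim (¬x∷xs↭[] (↭-sym p))
  step-exists (suc k) (e ∷ w) lt p with step-exists k w lt p
  ... | (w′ , st) , eq = (e ∷ w′ , there st) , eq
  step-exists zero (V x ∷ H y ∷ w) {[]} lt p = (_ , here lt p) , refl
  step-exists zero (V x ∷ H y ∷ w) {_ ∷ _} lt p with () ← ↭-length p
  step-exists zero (V x ∷ []) lt p with () ← ↭-length p
  step-exists zero (V x ∷ V y ∷ w) lt p with () ← ↭-length p
  step-exists zero (H x ∷ []) lt p with () ← ↭-length p
  step-exists zero (H x ∷ V y ∷ w) lt p with () ← ↭-length p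
  step-exists zero (H x ∷ H y ∷ w) lt p with () ← ↭-length p

-- Topplings of configurations as steps of words

Encodes : ∀ {n} → Config n → List Edge → Set
Encodes {n} c w = length w ≡ suc n × (∀ s → c s ↭ site [] w (toℕ s))

toppled : ∀ {n} → Config n → Fin n → ℕ → ℕ → Config n
toppled c i α β =
  update (update (update c (midSite i) []) (leftSite i) (α ∷ c (leftSite i)))
         (rightSite i) (β ∷ c (rightSite i))

toℕ-leftSite : ∀ {n} (i : Fin n) → toℕ (leftSite i) ≡ toℕ i
toℕ-leftSite i = trans (toℕ-inject₁ (inject₁ i)) (toℕ-inject₁ i)

toℕ-midSite : ∀ {n} (i : Fin n) → toℕ (midSite i) ≡ suc (toℕ i)
toℕ-midSite i = cong suc (toℕ-inject₁ i)

toppled-encodes : ∀ {n} {c : Config n} {w w′ α β} i → Encodes c w → Step (toℕ i) α β w w′ →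
                  Encodes (toppled c i α β) w′
toppled-encodes {c = c} {w} {w′} {α} {β} i (len , enc) st = trans (step-length st) len , go
  where
  go : ∀ s → toppled c i α β s ↭ site [] w′ (toℕ s)
  -- The tests follow the nesting of `update` from the outside in, so that each `update` reduces.
  go s with rightSite i ≟ s
  ... | yes refl = ↭-trans (prep β (enc (rightSite i))) (↭-reflexive (sym (step-right st)))
  ... | no r≢ with leftSite i ≟ s
  ...   | yes refl = ↭-trans (prep α (enc (leftSite i)))
            (subst (λ k → α ∷ site [] w k ↭ site [] w′ k) (sym (toℕ-leftSite i)) (↭-sym (step-left st)))
  ...   | no l≢ with midSite i ≟ s
  ...     | yes refl = ↭-reflexive (sym (trans (cong (site [] w′) (toℕ-midSite i)) (step-mid′ st)))
  ...     | no m≢ = ↭-trans (enc s) (↭-reflexive (sym (step-other st (toℕ s)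
              (λ eq → l≢ (toℕ-injective (trans (toℕ-leftSite i) (sym eq))))
              (λ eq → m≢ (toℕ-injective (trans (toℕ-midSite i) (sym eq))))
              (λ eq → r≢ (toℕ-injective (sym eq))))))

topple⇒step : ∀ {n} {c c′ : Config n} {w} → Encodes c w → Topple c c′ →
              ∃ λ w′ → w ⟶ w′ × Encodes c′ w′
topple⇒step {w = w} e@(len , enc) (topple i α β rest lt p)
  with (w′ , st) , refl ← step-exists (toℕ i) w lt
         (subst (λ k → site [] w k ↭ α ∷ β ∷ rest) (toℕ-midSite i) (↭-trans (↭-sym (enc (midSite i))) p))
  = w′ , (toℕ i , α , β , st) , toppled-encodes i e st

step⇒topple : ∀ {n} {c : Config n} {w w′} → Encodes c w → w ⟶ w′ →
              ∃ λ c′ → Topple c c′ × Encodes c′ w′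
step⇒topple {n} {c} {w} {w′} e@(len , enc) (k , α , β , st) =
  toppled c i α β , topple i α β [] (step-< st) p , toppled-encodes i e st′
  where
  k<n : k < n
  k<n = s≤s⁻¹ (subst (suc k <_) len (step-index st))
  i = fromℕ< k<n
  st′ : Step (toℕ i) α β w w′
  st′ = subst (λ k → Step k α β w w′) (sym (toℕ-fromℕ< k<n)) st
  p : c (midSite i) ↭ α ∷ β ∷ []
  p = ↭-trans (enc (midSite i)) (subst (λ k → site [] w k ↭ α ∷ β ∷ []) (sym (toℕ-midSite i)) (step-mid st′))

run⇒steps : ∀ {n} {c c′ : Config n} {w} → Encodes c w → Star Topple c c′ →
            ∃ λ w′ → Star _⟶_ w w′ × Encodes c′ w′
run⇒steps e ε = _ , ε , e
run⇒steps e (t ◅ ts) with _ , s , e₁ ← topple⇒step e t with _ , ss , e₂ ← run⇒steps e₁ ts = _ , s ◅ ss , e₂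

steps⇒run : ∀ {n} {c : Config n} {w w′} → Encodes c w → Star _⟶_ w w′ →
            ∃ λ c′ → Star Topple c c′ × Encodes c′ w′
steps⇒run e ε = _ , ε , e
steps⇒run e (s ◅ ss) with _ , t , e₁ ← step⇒topple e s with _ , ts , e₂ ← steps⇒run e₁ ss = _ , t ◅ ts , e₂

steps-chips : ∀ {w w′} → Star _⟶_ w w′ → map label w ↭ map label w′
steps-chips ε = ↭-refl
steps-chips ((_ , _ , _ , st) ◅ ss) = ↭-trans (step-chips st) (steps-chips ss)

-- On a site with at most one chip the encoding up to `↭` becomes an equality, which makes the
-- reading of a stable configuration computable from its word.
short-↭ : ∀ {xs ys : List ℕ} → length ys ≤ 1 → xs ↭ ys → xs ≡ ys
short-↭ {ys = []} _ p = ↭-empty-inv p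
short-↭ {ys = _ ∷ []} _ p = ↭-singleton-inv p
short-↭ {ys = _ ∷ _ ∷ _} (s≤s ()) p

before++after : ∀ e → before e ++ after e ≡ label e ∷ []
before++after (V x) = refl
before++after (H x) = refl

-- Each letter puts its chip on one of the two sites around it, and on a shared site the chip of the
-- left letter comes first; so sites and letters are read in the same order.
concat-sites : ∀ cs w → concat (applyUpTo (site cs w) (suc (length w))) ≡ cs ++ map label w
concat-sites cs [] = refl
concat-sites cs (e ∷ w) = begin
  (cs ++ before e) ++ concat (applyUpTo (site (after e) w) (suc (length w)))
    ≡⟨ cong ((cs ++ before e) ++_) (concat-sites (after e) w) ⟩
  (cs ++ before e) ++ (after e ++ map label w)  ≡⟨ ++-assoc cs (before e) _ ⟩
  cs ++ (before e ++ (after e ++ map label w))  ≡⟨ cong (cs ++_) (sym (++-assoc (before e) (after e) _)) ⟩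
  cs ++ ((before e ++ after e) ++ map label w)  ≡⟨ cong (λ z → cs ++ (z ++ map label w)) (before++after e) ⟩
  cs ++ (label e ∷ map label w) ∎
  where open ≡-Reasoning

tabulate-toℕ : ∀ {A : Set} (f : ℕ → A) n → tabulate {n = n} (f ∘ toℕ) ≡ applyUpTo f n
tabulate-toℕ f zero = refl
tabulate-toℕ f (suc n) = cong (f 0 ∷_) (tabulate-toℕ (f ∘ suc) n)

reading-word : ∀ {n} {c : Config n} {w} → Encodes c w →
               (∀ s → c s ≡ site [] w (toℕ s)) → reading c ≡ map label w
reading-word {n} {c} {w} (len , _) eq = begin
  concat (map c (allFin (2 + n)))                   ≡⟨ cong concat (map-tabulate (λ i → i) c) ⟩
  concat (tabulate c)                               ≡⟨ cong concat (tabulate-cong eq) ⟩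
  concat (tabulate {n = 2 + n} (site [] w ∘ toℕ))   ≡⟨ cong concat (tabulate-toℕ (site [] w) (2 + n)) ⟩
  concat (applyUpTo (site [] w) (2 + n))
    ≡⟨ cong (λ m → concat (applyUpTo (site [] w) (suc m))) (sym len) ⟩
  concat (applyUpTo (site [] w) (suc (length w)))   ≡⟨ concat-sites [] w ⟩
  map label w ∎
  where open ≡-Reasoning

Unique-resp-↭ : ∀ {A : Set} {xs ys : List A} → xs ↭ ys → Unique xs → Unique ys
Unique-resp-↭ {A} p = ↭ₛ.Unique-resp-↭ (setoid A) (↭⇒↭ₛ p)

-- The two-sided invariant

#V : List Edge → ℕ
#V []        = 0
#V (V _ ∷ w) = suc (#V w)
#V (H _ ∷ w) = #V w

#V≤length : ∀ w → #V w ≤ length w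
#V≤length []        = z≤n
#V≤length (V _ ∷ w) = s≤s (#V≤length w)
#V≤length (H _ ∷ w) = m≤n⇒m≤1+n (#V≤length w)

-- Here `h` counts the letters `H` before the chip `x` and `v` the letters `V` after it; in use `N`
-- is n+1, the largest chip.
Fits : ℕ → ℕ → ℕ → ℕ → Set
Fits N h v x = x + v ≤ N × h < x

Confined : ℕ → ℕ → List Edge → Set
Confined N h []        = ⊤
Confined N h (V x ∷ w) = Fits N h (#V w) x × Confined N h w
Confined N h (H x ∷ w) = Fits N h (#V w) x × Confined N (suc h) w

step-#V : ∀ {k α β w w′} → Step k α β w w′ → #V w ≡ #V w′
step-#V (here _ _) = refl
step-#V (there {V _} st) = cong suc (step-#V st)
step-#V (there {H _} st) = step-#V st

-- The chip `α` gains one `V` after it, which `α < β` and the bound on `β` absorb; `β` gains one `H`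
-- before it, absorbed by `h < α < β`. The counts for all other letters stay the same.
step-Confined : ∀ {k α β w w′ N h} → Step k α β w w′ → Confined N h w → Confined N h w′
step-Confined {N = N} {h} (here {α = α} {β} {w} lt xy) (fx , fy , i)
  with (αv , hα) ∷ (βv , hβ) ∷ [] ← All-resp-↭ {P = Fits N h (#V w)} xy (fx ∷ fy ∷ [])
  = (≤-trans (≤-reflexive (+-suc α (#V w))) (≤-trans (+-monoˡ-≤ (#V w) lt) βv) , hα)
  , (βv , ≤-trans (s≤s hα) lt) , i
step-Confined {N = N} {h} (there {V x} st) (fx , i) =
  subst (λ v → Fits N h v x) (step-#V st) fx , step-Confined st i
step-Confined {N = N} {h} (there {H x} st) (fx , i) =
  subst (λ v → Fits N h v x) (step-#V st) fx , step-Confined st i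

-- Backwards the bounds only become weaker: `α` loses a `V` after it and `β` loses an `H` before it.
step-Confined⁻ : ∀ {k α β w w′ N h} → Step k α β w w′ → Confined N h w′ → Confined N h w
step-Confined⁻ {N = N} {h} (here {α = α} {β} {w} lt xy) ((αv , hα) , (βv , hβ) , i)
  with fx ∷ fy ∷ [] ← All-resp-↭ {P = Fits N h (#V w)} (↭-sym xy)
         ((≤-trans (+-monoʳ-≤ α (n≤1+n _)) αv , hα) ∷ (βv , <-trans (n<1+n h) hβ) ∷ [])
  = fx , fy , i
step-Confined⁻ {N = N} {h} (there {V x} st) (fx , i) =
  subst (λ v → Fits N h v x) (sym (step-#V st)) fx , step-Confined⁻ st i
step-Confined⁻ {N = N} {h} (there {H x} st) (fx , i) =
  subst (λ v → Fits N h v x) (sym (step-#V st)) fx , step-Confined⁻ st i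

steps-Confined : ∀ {w w′ N h} → Star _⟶_ w w′ → Confined N h w → Confined N h w′
steps-Confined ε i = i
steps-Confined ((_ , _ , _ , st) ◅ ss) i = steps-Confined ss (step-Confined st i)

steps-Confined⁻ : ∀ {w w′ N h} → Star _⟶_ w w′ → Confined N h w′ → Confined N h w
steps-Confined⁻ ε i = i
steps-Confined⁻ ((_ , _ , _ , st) ◅ ss) i = step-Confined⁻ st (steps-Confined⁻ ss i)

up : ℕ → ℕ → List ℕ
up k zero    = []
up k (suc m) = suc k ∷ up (suc k) m

applyUpTo-up : ∀ k m (f : ℕ → ℕ) → (∀ i → f i ≡ suc (k + i)) → applyUpTo f m ≡ up k m
applyUpTo-up k zero    f eq = refl
applyUpTo-up k (suc m) f eq = cong₂ _∷_ (trans (eq 0) (cong suc (+-identityʳ k)))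
  (applyUpTo-up (suc k) m (f ∘ suc) (λ i → trans (eq (suc i)) (cong suc (+-suc k i))))

∈-up : ∀ k m {y} → k < y → y ≤ k + m → y ∈ up k m
∈-up k zero {y} k<y y≤ = ⊥-elim (<-irrefl refl (≤-trans k<y (≤-trans y≤ (≤-reflexive (+-identityʳ k)))))
∈-up k (suc m) {y} k<y y≤ with m≤n⇒m<n∨m≡n k<y
... | inj₁ lt = there (∈-up (suc k) m lt (≤-trans y≤ (≤-reflexive (+-suc k m))))
... | inj₂ refl = here refl

-- In an increasing word the chip k+1 has k letters before it and at most N-k-1 after it, which
-- bounds the letters `H` and `V` among them.
sorted⇒Confined : ∀ {N h k} w → h ≤ k → k + length w ≤ N → map label w ≡ up k (length w) → Confined N h w
sorted⇒Confined [] _ _ _ = tt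
sorted⇒Confined {N} {h} {k} (e ∷ w) h≤k le eq with e | ∷-injective eq
... | V _ | refl , eq′ = (≤-trans (+-monoʳ-≤ (suc k) (#V≤length w)) le′ , s≤s h≤k)
                         , sorted⇒Confined w (m≤n⇒m≤1+n h≤k) le′ eq′
  where le′ = ≤-trans (≤-reflexive (sym (+-suc k (length w)))) le
... | H _ | refl , eq′ = (≤-trans (+-monoʳ-≤ (suc k) (#V≤length w)) le′ , s≤s h≤k)
                         , sorted⇒Confined w (s≤s h≤k) le′ eq′
  where le′ = ≤-trans (≤-reflexive (sym (+-suc k (length w)))) le

-- Normal forms

data Normal : List Edge → Set where
  allV : ∀ xs → Normal (map V xs)
  _H∷_ : ∀ y {w} → Normal w → Normal (H y ∷ w)

there* : ∀ e {w w′} → Star _⟶_ w w′ → Star _⟶_ (e ∷ w) (e ∷ w′)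
there* e = gmap (e ∷_) (λ (k , α , β , st) → suc k , α , β , there st)

-- Where `V x` meets `H y`, the smaller chip is settled as an `H` and the larger one travels on as a
-- `V`. Uniqueness excludes `x ≡ y`, where no step is possible.
bubble : ∀ x {w} → Normal w → Unique (x ∷ map label w) → ∃ λ w′ → Star _⟶_ (V x ∷ w) w′ × Normal w′
bubble x (allV xs) _ = _ , ε , allV (x ∷ xs)
bubble x (y H∷ nf) ((x≢y ∷ x∉) ∷ y∉ ∷ u) with <-cmp x y
... | tri< lt _ _ with _ , ss , nf′ ← bubble y nf (y∉ ∷ u)
    = _ , (0 , _ , _ , here lt ↭-refl) ◅ there* _ ss , x H∷ nf′
... | tri≈ _ eq _ = contradiction eq x≢y
... | tri> _ _ gt with _ , ss , nf′ ← bubble x nf (x∉ ∷ u)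
    = _ , (0 , _ , _ , here gt (↭-swap _ _ ↭-refl)) ◅ there* _ ss , y H∷ nf′

-- Structural recursion on the word yields one terminating order of topplings; `InT` asks only for
-- the existence of a run.
normalise : ∀ w → Unique (map label w) → ∃ λ w′ → Star _⟶_ w w′ × Normal w′
normalise [] u = _ , ε , allV []
normalise (H y ∷ w) (_ ∷ u) with _ , ss , nf ← normalise w u = _ , there* _ ss , y H∷ nf
normalise (V x ∷ w) (x∉ ∷ u)
  with _ , ss , nf ← normalise w u
  with _ , ss′ , nf′ ← bubble x nf (Unique-resp-↭ (prep x (steps-chips ss)) (x∉ ∷ u))
  = _ , there* _ ss ◅◅ ss′ , nf′

-- Two chips share a site only where a `V` is directly followed by an `H`.
normal-stable : ∀ {w} → Normal w → ∀ k → length (site [] w k) ≤ 1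
normal-stable (allV xs) k = go [] xs z≤n k
  where
  go : ∀ cs xs → length cs ≤ 1 → ∀ k → length (site cs (map V xs) k) ≤ 1
  go cs []       le zero    = le
  go cs []       le (suc k) = z≤n
  go cs (x ∷ xs) le zero    = ≤-trans (≤-reflexive (cong length (++-identityʳ cs))) le
  go cs (x ∷ xs) le (suc k) = go (x ∷ []) xs ≤-refl k
normal-stable (y H∷ nf) zero = ≤-refl
normal-stable (y H∷ nf) (suc k) = normal-stable nf k

-- Letters `V` do not raise `h`, so once the chip h+1 is used up, distinctness has to sharpen the
-- lower bound for the remaining chips.
Confined-V-suc : ∀ {N h} xs → Confined N h (map V xs) → All (suc h ≢_) (map label (map V xs)) →
                 Confined N (suc h) (map V xs)
Confined-V-suc [] _ _ = tt
Confined-V-suc (x ∷ xs) ((le , h<x) , i) (≢x ∷ ≢s) = (le , ≤∧≢⇒< h<x ≢x) , Confined-V-suc xs i ≢s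

#V-map-V : ∀ xs → #V (map V xs) ≡ length (map V xs)
#V-map-V []       = refl
#V-map-V (_ ∷ xs) = cong suc (#V-map-V xs)

-- A leading `V` has all remaining letters, each a `V`, after it, so its upper bound forces the chip
-- h+1. After a leading `H y` the tail is h+2, ..., N by induction, and any `y` above h+1 would
-- repeat one of these.
normal-sorted : ∀ {N h w} → Normal w → Confined N h w → Unique (map label w) → N ≡ h + length w →
                map label w ≡ up h (length w)
normal-sorted (allV []) _ _ _ = refl
normal-sorted {N} {h} (allV (x ∷ xs)) ((le , h<x) , i) (x∉ ∷ u) eq
  with refl ← ≤-antisym (+-cancelʳ-≤ _ x (suc h)
         (≤-trans le (≤-reflexive (trans eq (trans (+-suc h _) (cong (suc h +_) (sym (#V-map-V xs)))))))) h<x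
  = cong (suc h ∷_) (normal-sorted (allV xs) (Confined-V-suc xs i x∉) u (trans eq (+-suc h _)))
normal-sorted {N} {h} {H y ∷ w} (y H∷ nf) ((le , h<y) , i) (y∉ ∷ u) eq
  with ih ← normal-sorted nf i u (trans eq (+-suc h _))
  with m≤n⇒m<n∨m≡n h<y
... | inj₂ refl = cong (suc h ∷_) ih
... | inj₁ lt = ⊥-elim (All.lookup y∉ (subst (y ∈_) (sym ih)
        (∈-up (suc h) _ lt (≤-trans (m≤m+n y _) (≤-trans le (≤-reflexive (trans eq (+-suc h _))))))) refl)

-- The initial word

initWord : List ℕ → ℕ → List ℕ → List Edge
initWord ys r zs = map V ys ++ H r ∷ map H zs

nth : List ℕ → ℕ → List ℕ
nth []       _       = []
nth (x ∷ xs) zero    = x ∷ []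
nth (x ∷ xs) (suc k) = nth xs k

site-map-H : ∀ zs k → site [] (map H zs) k ≡ nth zs k
site-map-H []       zero    = refl
site-map-H []       (suc k) = refl
site-map-H (z ∷ zs) zero    = refl
site-map-H (z ∷ zs) (suc k) = site-map-H zs k

-- The chip `y` of the preceding `V` is carried in, so site `k` here is site `k + 1` of the whole
-- word, and `r` sits one index lower as well.
site-initWord : ∀ y ys r zs k → site (y ∷ []) (initWord ys r zs) k
                ≡ nth (y ∷ ys ++ zs) k ++ (if k ≡ᵇ length ys then r ∷ [] else [])
site-initWord y []        r zs zero    = refl
site-initWord y []        r zs (suc k) = trans (site-map-H zs k) (sym (++-identityʳ _))
site-initWord y (y′ ∷ ys) r zs zero    = refl
site-initWord y (y′ ∷ ys) r zs (suc k) = site-initWord y′ ys r zs k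

concatMap-[] : ∀ {A B : Set} (g : A → List B) → (∀ x → g x ≡ []) → ∀ xs → concatMap g xs ≡ []
concatMap-[] g eq []       = refl
concatMap-[] g eq (x ∷ xs) rewrite eq x = concatMap-[] g eq xs

concatMap-tabulate : ∀ {A : Set} {n m} (g : Fin m → List A) (h : Fin n → Fin m) →
                     concatMap g (tabulate h) ≡ concatMap (g ∘ h) (allFin n)
concatMap-tabulate {n = n} g h = cong concat (trans (map-tabulate h g) (sym (map-tabulate (λ i → i) (g ∘ h))))

isYes-suc : ∀ {n} (i j : Fin n) → isYes (suc i ≟ suc j) ≡ isYes (i ≟ j)
isYes-suc i j with i ≟ j
... | yes _ = refl
... | no  _ = refl

-- The range of `j` includes the last site, n+1, which is empty because `nth` runs past the end
-- there.
chips-at-suc : ∀ {n} (f : Fin n → ℕ) (j : Fin (suc n)) →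
  concatMap (λ i → if isYes (midSite i ≟ suc j) then f i ∷ [] else []) (allFin n) ≡ nth (tabulate f) (toℕ j)
chips-at-suc {zero}  f j = refl
chips-at-suc {suc n} f zero = cong (f zero ∷_) (trans
  (concatMap-tabulate {n = n} (λ i → if isYes (midSite i ≟ suc zero) then f i ∷ [] else []) suc)
  (concatMap-[] _ (λ _ → refl) (allFin n)))
chips-at-suc {suc n} f (suc j) = trans
  (concatMap-tabulate (λ i → if isYes (midSite i ≟ suc (suc j)) then f i ∷ [] else []) suc)
  (trans (concatMap-cong
      (λ i → cong (if_then f (suc i) ∷ [] else []) (isYes-suc (midSite i) (suc j))) (allFin n))
    (chips-at-suc (f ∘ suc) j))

length-initWord : ∀ ys r zs → length (initWord ys r zs) ≡ suc (length (ys ++ zs))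
length-initWord []       r zs = cong suc (length-map H zs)
length-initWord (y ∷ ys) r zs = cong suc (length-initWord ys r zs)

chips-initWord : ∀ ys r zs → map label (initWord ys r zs) ↭ r ∷ ys ++ zs
chips-initWord ys r zs = ↭-trans (↭-reflexive eq) (shift r ys zs)
  where
  labels-H : ∀ zs → map label (map H zs) ≡ zs
  labels-H [] = refl
  labels-H (z ∷ zs) = cong (z ∷_) (labels-H zs)
  labels-V : ∀ ys → map label (map V ys) ≡ ys
  labels-V [] = refl
  labels-V (z ∷ zs) = cong (z ∷_) (labels-V zs)
  eq : map label (initWord ys r zs) ≡ ys ++ r ∷ zs
  eq = trans (map-++ label (map V ys) _) (cong₂ _++_ (labels-V ys) (cong (r ∷_) (labels-H zs)))

Indexed : (ℕ → ℕ → Set) → ℕ → List ℕ → Set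
Indexed P k []       = ⊤
Indexed P k (x ∷ xs) = P k x × Indexed P (suc k) xs

Indexed-tabulate⁺ : ∀ {P n} k (f : Fin n → ℕ) → (∀ i → P (k + toℕ i) (f i)) → Indexed P k (tabulate f)
Indexed-tabulate⁺ {P} {zero} k f h = tt
Indexed-tabulate⁺ {P} {suc n} k f h = subst (λ j → P j (f zero)) (+-identityʳ k) (h zero)
  , Indexed-tabulate⁺ (suc k) (f ∘ suc) (λ i → subst (λ j → P j (f (suc i))) (+-suc k (toℕ i)) (h (suc i)))

Indexed-tabulate⁻ : ∀ {P n} k (f : Fin n → ℕ) → Indexed P k (tabulate f) → ∀ i → P (k + toℕ i) (f i)
Indexed-tabulate⁻ {P} k f (px , _) zero = subst (λ j → P j (f zero)) (sym (+-identityʳ k)) px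
Indexed-tabulate⁻ {P} k f (_ , pxs) (suc i) =
  subst (λ j → P j (f (suc i))) (sym (+-suc k (toℕ i))) (Indexed-tabulate⁻ (suc k) (f ∘ suc) pxs i)

-- `Fits` for the chip `v` at position `c`, counted from 0 and free of subtraction. The first half
-- is the bound for a `V`, with p-1-c letters `V` after it; the second is the bound for an `H`, with
-- c-p+1 letters `H` before it. In each case the other half follows from 1 ≤ v ≤ n+1.
WellPlaced : ℕ → ℕ → ℕ → ℕ → Set
WellPlaced n p c v = v + p ≤ 2 + n + c × suc c < v + p

#V-map-H : ∀ zs → #V (map H zs) ≡ 0
#V-map-H []       = refl
#V-map-H (_ ∷ zs) = #V-map-H zs

#V-initWord : ∀ ys r zs → #V (initWord ys r zs) ≡ length ys
#V-initWord []       r zs = #V-map-H zs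
#V-initWord (y ∷ ys) r zs = cong suc (#V-initWord ys r zs)

Confined-H⇔ : ∀ {n p h c} zs → suc c ≡ p + h → All (λ z → z ≤ suc n) zs →
              Confined (suc n) h (map H zs) ⇔ Indexed (WellPlaced n p) c zs
Confined-H⇔ [] _ _ = mk⇔ (λ _ → tt) (λ _ → tt)
Confined-H⇔ {n} {p} {h} {c} (z ∷ zs) eq (z≤ ∷ zs≤) = mk⇔
  (λ ((_ , h<z) , i) → (lower , subst₂ _<_ (sym eq) (+-comm p z) (+-monoʳ-< p h<z)) , to i)
  (λ ((_ , lt) , g) → (≤-trans (≤-reflexive (trans (cong (z +_) (#V-map-H zs)) (+-identityʳ z))) z≤ ,
                        +-cancelˡ-< p h z (subst₂ _<_ eq (+-comm z p) lt)) , from g)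
  where
  open Equivalence (Confined-H⇔ {n} {p} {suc h} {suc c} zs (trans (cong suc eq) (sym (+-suc p h))) zs≤)
  lower : z + p ≤ 2 + n + c
  lower = ≤-trans (+-mono-≤ z≤ (≤-trans (m≤m+n p h) (≤-reflexive (sym eq))))
    (≤-reflexive (cong suc (+-suc n c)))

-- Along `ys` no `H` has been passed and p = c+1+v for the `v` letters `V` still to come. The letter
-- `H r` has no `H` before it and no `V` after it, so it fits by 1 ≤ r ≤ n+1.
Confined-initWord⇔ : ∀ {n p r c} ys zs → c + length ys ≡ p → 1 ≤ r → r ≤ suc n →
  All (λ z → 1 ≤ z × z ≤ suc n) (ys ++ zs) →
  Confined (suc n) 0 (initWord ys r zs) ⇔ Indexed (WellPlaced n p) c (ys ++ zs)
Confined-initWord⇔ {n} {p} {r} {c} [] zs eq r≥ r≤ b = mk⇔ (λ (_ , i) → to i)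
  (λ g → (≤-trans (≤-reflexive (trans (cong (r +_) (#V-map-H zs)) (+-identityʳ r))) r≤ , r≥) , from g)
  where
  -- The count of `H` starts at 1 because `H r` has been passed.
  open Equivalence (Confined-H⇔ {n} {p} {1} {c} zs
    (trans (cong suc (trans (sym (+-identityʳ c)) eq)) (+-comm 1 p)) (All.map proj₂ b))
Confined-initWord⇔ {n} {p} {r} {c} (y ∷ ys) zs eq r≥ r≤ ((y≥ , y≤) ∷ b) = mk⇔
  (λ ((le , _) , i) → (subst₂ _≤_ (sym lhs) rhs (+-monoʳ-≤ (suc c) le) , upper) , to i)
  (λ ((le , _) , g) → (+-cancelˡ-≤ (suc c) _ _ (subst₂ _≤_ lhs (sym rhs) le) , y≥) , from g)
  where
  open Equivalence (Confined-initWord⇔ {n} {p} {r} {suc c} ys zs (trans (sym (+-suc c _)) eq) r≥ r≤ b)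
  v = #V (initWord ys r zs)
  p≡ : p ≡ suc c + v
  p≡ = trans (sym eq) (trans (+-suc c _) (cong (suc c +_) (sym (#V-initWord ys r zs))))
  lhs : y + p ≡ suc c + (y + v)
  lhs = trans (cong (y +_) p≡) (trans (sym (+-assoc y (suc c) v))
          (trans (cong (_+ v) (+-comm y (suc c))) (+-assoc (suc c) y v)))
  rhs : suc c + suc n ≡ 2 + n + c
  rhs = trans (+-comm (suc c) (suc n)) (cong suc (+-suc n c))
  upper : suc c < y + p
  upper = +-mono-≤ y≥ (≤-trans (m≤m+n (suc c) v) (≤-reflexive (sym p≡)))

-- Sorting to the identity

chipOf-< : ∀ {r v} → v < r → chipOf r v ≡ v
chipOf-< {r} {v} lt with v <ᵇ r | <⇒<ᵇ lt
... | true | _ = refl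

chipOf-≥ : ∀ {r v} → r ≤ v → chipOf r v ≡ suc v
chipOf-≥ {r} {v} le with v <ᵇ r | <ᵇ⇒< v r
... | true  | f = contradiction (f tt) (≤⇒≯ le)
... | false | _ = refl

chipOf-bounds : ∀ r v → v ≤ chipOf r v × chipOf r v ≤ suc v
chipOf-bounds r v with v <ᵇ r
... | true  = ≤-refl , n≤1+n v
... | false = n≤1+n v , ≤-refl

chipOf-≢ : ∀ r v → r ≢ chipOf r v
chipOf-≢ r v eq with v <? r
... | yes lt = <-irrefl (trans (sym (chipOf-< lt)) (sym eq)) lt
... | no ≮ = <-irrefl (trans eq (chipOf-≥ (≮⇒≥ ≮))) (s≤s (≮⇒≥ ≮))

chipOf-injective : ∀ r {u v} → chipOf r u ≡ chipOf r v → u ≡ v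
chipOf-injective r {u} {v} eq with u <? r | v <? r
... | yes a | yes b = trans (sym (chipOf-< a)) (trans eq (chipOf-< b))
... | no a  | no b  = suc-injective (trans (sym (chipOf-≥ (≮⇒≥ a))) (trans eq (chipOf-≥ (≮⇒≥ b))))
... | yes a | no b  = ⊥-elim (b (≤-trans
  (≤-reflexive (trans (sym (chipOf-≥ (≮⇒≥ b))) (trans (sym eq) (chipOf-< a)))) (<⇒≤ a)))
... | no a  | yes b = ⊥-elim (a (≤-trans
  (≤-reflexive (trans (sym (chipOf-≥ (≮⇒≥ a))) (trans eq (chipOf-< b)))) (<⇒≤ b)))

module _ {n : ℕ} (p : ℕ) (1≤p : 1 ≤ p) (p≤n : p ≤ n) (π : Permutation′ n) where

  module _ (r : ℕ) (1≤r : 1 ≤ r) (r≤ : r ≤ suc n) where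

    chip : Fin n → ℕ
    chip i = chipOf r (permVal π i)

    chips ys zs : List ℕ
    chips = tabulate chip
    ys = take p chips
    zs = drop p chips

    word : List Edge
    word = initWord ys r zs

    length-ys : length ys ≡ p
    length-ys = trans (length-take p chips) (trans (cong (p ⊓_) (length-tabulate chip)) (m≤n⇒m⊓n≡m p≤n))

    init-encodes : Encodes (initConfig π r p) word
    init-encodes = trans (length-initWord ys r zs)
      (cong suc (trans (cong length (take++drop≡id p chips)) (length-tabulate chip)))
      , λ s → ↭-reflexive (go s)
      where
      extra : ℕ → List ℕ
      extra k = if k ≡ᵇ p then r ∷ [] else []
      -- Since `1 ≤ p`, the word begins with a `V`, whose chip is carried to site 1.
      site-word : ∀ ys → length ys ≡ p → ys ++ zs ≡ chips → ∀ k →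
                  site [] (initWord ys r zs) (suc k) ≡ nth chips k ++ extra (suc k)
      site-word [] eq _ k = contradiction eq (<⇒≢ 1≤p)
      site-word (y ∷ ys) refl eq k = trans (site-initWord y ys r zs k) (cong (λ c → nth c k ++ _) eq)
      site-zero : ∀ ys → length ys ≡ p → site [] (initWord ys r zs) 0 ≡ extra 0
      site-zero [] eq = contradiction eq (<⇒≢ 1≤p)
      site-zero (y ∷ ys) refl = refl
      go : ∀ s → initConfig π r p s ≡ site [] word (toℕ s)
      go zero = trans (cong (_++ extra 0) (concatMap-[] _ (λ _ → refl) (allFin n)))
        (sym (site-zero ys length-ys))
      go (suc j) = trans (cong (_++ extra (suc (toℕ j))) (chips-at-suc chip j))
        (sym (site-word ys length-ys (take++drop≡id p chips) (toℕ j)))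

    bounds : All (λ z → 1 ≤ z × z ≤ suc n) (ys ++ zs)
    bounds = subst (All _) (sym (take++drop≡id p chips)) (All.tabulate⁺ λ i →
      let lo , hi = chipOf-bounds r (permVal π i) in
      ≤-trans (s≤s z≤n) lo , ≤-trans hi (s≤s (toℕ<n (π ⟨$⟩ʳ i))))

    Confined-word⇔ : Confined (suc n) 0 word ⇔ Indexed (WellPlaced n p) 0 chips
    Confined-word⇔ = subst (λ c → Confined (suc n) 0 word ⇔ Indexed (WellPlaced n p) 0 c)
      (take++drop≡id p chips)
      (Confined-initWord⇔ ys zs length-ys 1≤r r≤ bounds)

    word-unique : Unique (map label word)
    word-unique = Unique-resp-↭ (↭-sym (chips-initWord ys r zs))
      (subst (λ c → Unique (r ∷ c)) (sym (take++drop≡id p chips))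
        (All.tabulate⁺ (λ i → chipOf-≢ r (permVal π i)) ∷ Unique.tabulate⁺ inj))
      where
      inj : ∀ {i j} → chip i ≡ chip j → i ≡ j
      inj {i} {j} eq = trans (sym (inverseˡ π)) (trans (cong (π ⟨$⟩ˡ_)
        (toℕ-injective (suc-injective (chipOf-injective r eq)))) (inverseˡ π))

    -- The final word is increasing, hence confined, and confinement is pulled back along the run.
    InT⇒WellPlaced : InT n r p π → ∀ i → WellPlaced n p (toℕ i) (chip i)
    InT⇒WellPlaced (c , run , stable , sorted)
      with w , ss , e@(len , enc) ← run⇒steps init-encodes run
      = Indexed-tabulate⁻ 0 chip (Equivalence.to Confined-word⇔
          (steps-Confined⁻ ss (sorted⇒Confined w z≤n (≤-reflexive len)
          (trans (sym (reading-word e (λ s → sym (short-↭ (stable s) (↭-sym (enc s))))))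
            (trans sorted (trans (applyUpTo-up 0 (suc n) suc (λ _ → refl)) (cong (up 0) (sym len))))))))

    -- Confinement is carried forward to a normal form, which is stable, and increasing by
    -- `normal-sorted`.
    WellPlaced⇒InT : (∀ i → WellPlaced n p (toℕ i) (chip i)) → InT n r p π
    WellPlaced⇒InT good
      with w , ss , nf ← normalise word word-unique
      with c , run , e@(len , enc) ← steps⇒run init-encodes ss
      = c , run , (λ s → ≤-trans (≤-reflexive (cong length (eq s))) (normal-stable nf (toℕ s)))
      , trans (reading-word e eq) (trans (normal-sorted nf (steps-Confined ss (Equivalence.from Confined-word⇔
          (Indexed-tabulate⁺ 0 chip good))) (Unique-resp-↭ (steps-chips ss) word-unique) (sym len))
          (trans (cong (up 0) len) (sym (applyUpTo-up 0 (suc n) suc (λ _ → refl)))))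
      where
      eq : ∀ s → c s ≡ site [] w (toℕ s)
      eq s = short-↭ (normal-stable nf (toℕ s)) (enc s)

  -- Every value v becomes the chip v or v+1, so the extreme `r` decide: r = 1 turns all into v+1
  -- and gives the lower bound of the window, r = n+1 keeps all at v and gives the upper one.
  InAllT⇔Window : InAllT n p π ⇔ Window n p π
  InAllT⇔Window = mk⇔ to from
    where
    to : InAllT n p π → Window n p π
    to h i = lower , upper
      where
      c = π ⟨$⟩ˡ i
      val : permVal π c ≡ suc (toℕ i)
      val = cong (suc ∘ toℕ) (inverseʳ π)
      g₁ = InT⇒WellPlaced 1 ≤-refl (s≤s z≤n) (h 1 ≤-refl (s≤s z≤n)) c
      g₂ = InT⇒WellPlaced (suc n) (s≤s z≤n) ≤-refl (h (suc n) (s≤s z≤n) ≤-refl) c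
      low : suc (suc (toℕ i)) + p ≤ 2 + n + toℕ c
      low = subst (λ v → v + p ≤ 2 + n + toℕ c)
        (trans (chipOf-≥ {1} {permVal π c} (s≤s z≤n)) (cong suc val)) (proj₁ g₁)
      lower : p + suc (toℕ i) ≤ suc (toℕ c) + n
      lower = subst₂ _≤_ (+-comm (suc (toℕ i)) p) (cong suc (+-comm n (toℕ c))) (s≤s⁻¹ low)
      upper : suc (toℕ c) + 1 ≤ p + suc (toℕ i)
      upper = subst₂ _≤_ (+-comm 1 (suc (toℕ c))) (trans (cong (_+ p) (trans
        (chipOf-< (s≤s (toℕ<n (π ⟨$⟩ʳ c)))) val)) (+-comm (suc (toℕ i)) p)) (proj₂ g₂)
    from : Window n p π → InAllT n p π
    from win r 1≤r r≤ = WellPlaced⇒InT r 1≤r r≤ good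
      where
      good : ∀ c → WellPlaced n p (toℕ c) (chipOf r (permVal π c))
      good c with win (π ⟨$⟩ʳ c)
      ... | lower , upper rewrite inverseˡ π {c} =
        ≤-trans (+-monoˡ-≤ p (proj₂ (chipOf-bounds r (permVal π c))))
          (s≤s (subst₂ _≤_ (+-comm p _) (cong suc (+-comm (toℕ c) n)) lower))
        , ≤-trans (subst₂ _≤_ (+-comm (suc (toℕ c)) 1) (+-comm p _) upper)
            (+-monoˡ-≤ p (proj₁ (chipOf-bounds r (permVal π c))))

-- Counting permutations

module _ {n : ℕ} where

  ≈⇒≡ˡ : ∀ {π σ : Permutation′ n} → π ≈ σ → ∀ i → π ⟨$⟩ˡ i ≡ σ ⟨$⟩ˡ i
  ≈⇒≡ˡ {π} {σ} eq i = trans (sym (inverseˡ σ))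
    (cong (σ ⟨$⟩ˡ_) (trans (sym (eq (π ⟨$⟩ˡ i))) (inverseʳ π)))

  ⟨$⟩ˡ-injective : ∀ (π : Permutation′ n) {i j} → π ⟨$⟩ˡ i ≡ π ⟨$⟩ˡ j → i ≡ j
  ⟨$⟩ˡ-injective π eq = trans (sym (inverseʳ π)) (trans (cong (π ⟨$⟩ʳ_) eq) (inverseʳ π))

  module _ {P Q : Permutation′ n → Set} where

    count-⇔ : ∀ {k} → (∀ π → P π → Q π) → (∀ π → Q π → P π) → HasCount P k → HasCount Q k
    count-⇔ f g (L , sound , complete , distinct , len) =
      L , All.map (f _) sound , (λ π q → complete π (g π q)) , distinct , len

    count-⊎ : ∀ {a b} → (∀ {π σ} → P π → Q σ → ¬ (π ≈ σ)) →
              HasCount P a → HasCount Q b → HasCount (λ π → P π ⊎ Q π) (a + b)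
    count-⊎ disj (L , s , c , d , refl) (L′ , s′ , c′ , d′ , refl) =
      L ++ L′ , All.++⁺ (All.map inj₁ s) (All.map inj₂ s′) , complete
      , AllPairs.++⁺ d d′ (All.map (λ p → All.map (disj p) s′) s) , length-++ L
      where
      complete : ∀ π → P π ⊎ Q π → ∃ λ σ → σ ∈ L ++ L′ × π ≈ σ
      complete π (inj₁ p) with σ , σ∈ , eq ← c π p = σ , ∈-++⁺ˡ σ∈ , eq
      complete π (inj₂ q) with σ , σ∈ , eq ← c′ π q = σ , ∈-++⁺ʳ L σ∈ , eq

  module _ {P : Permutation′ n → Set} where

    count-∅ : (∀ π → ¬ P π) → HasCount P 0
    count-∅ ¬P = [] , [] , (λ π p → contradiction p (¬P π)) , [] , refl

    count-one : ∀ σ → P σ → (∀ π → P π → π ≈ σ) → HasCount P 1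
    count-one σ Pσ unique = σ ∷ [] , Pσ ∷ [] , (λ π p → σ , here refl , unique π p) , [] ∷ [] , refl

  module _ {P : Permutation′ n → Set} where

    -- The product rule for branching on the column of row `r`; permutations from different branches
    -- differ there.
    count-choose : ∀ {k} r S → Unique S →
      (∀ c → c ∈ S → HasCount (λ π → P π × π ⟨$⟩ˡ r ≡ c) k) →
      HasCount (λ π → P π × (π ⟨$⟩ˡ r) ∈ S) (length S * k)
    count-choose r [] _ _ = count-∅ {P = λ π → P π × (π ⟨$⟩ˡ r) ∈ []} (λ { π (_ , ()) })
    count-choose r (c ∷ S) (c∉ ∷ u) h = count-⇔
      {P = λ π → (P π × π ⟨$⟩ˡ r ≡ c) ⊎ (P π × (π ⟨$⟩ˡ r) ∈ S)} {Q = λ π → P π × (π ⟨$⟩ˡ r) ∈ c ∷ S}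
      (λ { π (inj₁ (p , eq)) → p , here eq ; π (inj₂ (p , m)) → p , there m })
      (λ { π (p , here eq) → inj₁ (p , eq) ; π (p , there m) → inj₂ (p , m) })
      (count-⊎ {P = λ π → P π × π ⟨$⟩ˡ r ≡ c} {Q = λ π → P π × (π ⟨$⟩ˡ r) ∈ S}
        (λ { {π} {σ} (_ , refl) (_ , m) eq → All.lookup c∉ m (≈⇒≡ˡ {π} {σ} eq r) })
        (h c (here refl)) (count-choose r S u (λ c′ m → h c′ (there m))))

-- Splitting and enumerating lists

module _ {A : Set} where

  ∈-split : ∀ {c} {xs : List A} → c ∈ xs → ∃ λ xs′ → xs ↭ c ∷ xs′
  ∈-split m with ys , zs , refl ← ∈-∃++ m = ys ++ zs , shift _ ys zs

  Unique-++ˡ : ∀ xs {ys : List A} → Unique (xs ++ ys) → Unique xs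
  Unique-++ˡ [] u = []
  Unique-++ˡ (x ∷ xs) (x∉ ∷ u) = All.++⁻ˡ xs x∉ ∷ Unique-++ˡ xs u

  Unique-++ʳ : ∀ xs {ys : List A} → Unique (xs ++ ys) → Unique ys
  Unique-++ʳ [] u = u
  Unique-++ʳ (x ∷ xs) (_ ∷ u) = Unique-++ʳ xs u

  -- A chosen column leaves the open list `xs` and joins the columns of the chosen pairs.
  move : ∀ {c} {xs xs′ : List A} ys → xs ↭ c ∷ xs′ → xs ++ ys ↭ xs′ ++ c ∷ ys
  move {c} {xs′ = xs′} ys p = ↭-trans (++⁺ʳ ys p) (↭-sym (shift c xs′ ys))

  Unique-map⇒injective : ∀ {B : Set} (f : A → B) {xs} → Unique (map f xs) →
    ∀ {x y} → x ∈ xs → y ∈ xs → f x ≡ f y → x ≡ y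
  Unique-map⇒injective f (_ ∷ _) (here refl) (here refl) eq = refl
  Unique-map⇒injective f (x∉ ∷ _) (here refl) (there m) eq =
    contradiction eq (All.lookup x∉ (∈-map⁺ f m))
  Unique-map⇒injective f (x∉ ∷ _) (there m) (here refl) eq =
    contradiction (sym eq) (All.lookup x∉ (∈-map⁺ f m))
  Unique-map⇒injective f (_ ∷ u) (there m) (there m′) eq = Unique-map⇒injective f u m m′ eq

  record Enum (P : A → Set) (xs : List A) : Set where
    constructor enum
    field
      unique   : Unique xs
      sound    : ∀ {c} → c ∈ xs → P c
      complete : ∀ {c} → P c → c ∈ xs

  open Enum public

  enum-resp-↭ : ∀ {P xs ys} → xs ↭ ys → Enum P xs → Enum P ys
  enum-resp-↭ p (enum u s c) = enum (Unique-resp-↭ p u) (s ∘ ∈-resp-↭ (↭-sym p)) (∈-resp-↭ p ∘ c)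

  enum-resp-⇔ : ∀ {P Q xs} → (∀ {c} → P c → Q c) → (∀ {c} → Q c → P c) → Enum P xs → Enum Q xs
  enum-resp-⇔ f g (enum u s c) = enum u (f ∘ s) (c ∘ g)

  enum-∷ : ∀ {P Q xs y} → ¬ P y → Q y → (∀ {c} → P c → Q c) → (∀ {c} → Q c → c ≡ y ⊎ P c) →
           Enum P xs → Enum Q (y ∷ xs)
  enum-∷ {P} {Q} {xs} {y} ¬Py Qy f g (enum u s c) =
    enum (All.tabulate (λ m eq → ¬Py (subst P (sym eq) (s m))) ∷ u) s′ (c′ ∘ g)
    where
    s′ : ∀ {c} → c ∈ y ∷ xs → Q c
    s′ (here refl) = Qy
    s′ (there m)   = f (s m)
    c′ : ∀ {c} → c ≡ y ⊎ P c → c ∈ y ∷ xs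
    c′ (inj₁ refl) = here refl
    c′ (inj₂ p)    = there (c p)

-- An open left column is of no use to the deferred rows, so none may be left when they are filled.
finalCount : ℕ → ℕ → ℕ
finalCount zero    r = r !
finalCount (suc _) r = 0

-- `t` top rows are still to be filled, with `l` left and `r` right columns open. Each row also
-- opens a right column, so choosing a right one leaves `r` unchanged.
topCount : ℕ → ℕ → ℕ → ℕ
topCount zero    l r = finalCount l r
topCount (suc t) l r = l * topCount t (pred l) (suc r) + r * topCount t l r

-- `i` bottom rows remain, `k` left columns are open, and `g` counts the completions afterwards.
-- Each row first opens a left column, then takes one of `suc k` or is deferred.
bottomCount : (ℕ → ℕ) → ℕ → ℕ → ℕ
bottomCount g zero    k = g k
bottomCount g (suc i) k = suc k * bottomCount g i k + bottomCount g i (suc k)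

-- Filling the rows with columns

module Matching (p q : ℕ) where

  n : ℕ
  n = p + q

  Pairs : Set
  Pairs = List (Fin n × Fin n)

  -- Literally the window inequalities, so that `Window n p π` unfolds to `Allowed i (π ⟨$⟩ˡ i)` for
  -- all `i`.
  Allowed : Fin n → Fin n → Set
  Allowed r c = (p + suc (toℕ r) ≤ suc (toℕ c) + n) × (suc (toℕ c) + 1 ≤ p + suc (toℕ r))

  exchange : ∀ a b c → a + (b + c) ≡ b + (a + c)
  exchange = solve-∀

  allowed⁺ : ∀ {r c} → toℕ r ≤ toℕ c + q → toℕ c < p + toℕ r → Allowed r c
  allowed⁺ {r} {c} lo hi =
    subst₂ _≤_ (sym (+-suc p (toℕ r))) (cong suc (exchange p (toℕ c) q)) (s≤s (+-monoʳ-≤ p lo))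
    , subst₂ _≤_ (+-comm 1 (suc (toℕ c))) (sym (+-suc p (toℕ r))) (s≤s hi)

  allowed⇒≤ : ∀ {r c} → Allowed r c → toℕ r ≤ toℕ c + q
  allowed⇒≤ {r} {c} (lo , _) =
    +-cancelˡ-≤ p _ _ (s≤s⁻¹ (subst₂ _≤_ (+-suc p (toℕ r)) (cong suc (sym (exchange p (toℕ c) q))) lo))

  allowed⇒< : ∀ {r c} → Allowed r c → toℕ c < p + toℕ r
  allowed⇒< {r} {c} (_ , hi) = s≤s⁻¹ (subst₂ _≤_ (+-comm (suc (toℕ c)) 1) (+-suc p (toℕ r)) hi)

  Extends : Pairs → List (Fin n) → Permutation′ n → Set
  Extends F D π = Window n p π × All (λ (r , c) → π ⟨$⟩ˡ r ≡ c) F × All (λ d → p ≤ toℕ (π ⟨$⟩ˡ d)) D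

  -- F is the list of (row, column) pairs chosen so far, D the deferred rows, OL and OR the open
  -- left and right columns; R and C describe the rows and columns that have been introduced.
  record State (R C : Fin n → Set) (F : Pairs) (D OL OR : List (Fin n)) : Set where
    constructor state
    field
      cols    : Enum C (OL ++ OR ++ map proj₂ F)
      rows    : Enum R (D ++ map proj₁ F)
      allowed : All (λ (r , c) → Allowed r c) F
      left    : All (λ c → toℕ c < p) OL
      right   : All (λ c → p ≤ toℕ c) OR
      bottom  : All (λ d → q ≤ toℕ d) D
      balance : length D ≡ length OL + length OR
  open State

  fresh-col : ∀ {F D π x} → Extends F D π → x ∉ map proj₁ F → (π ⟨$⟩ˡ x) ∉ map proj₂ F
  fresh-col {F} {π = π} (_ , forced , _) x∉ m with (r , c) , rc∈ , eq ← ∈-map⁻ proj₂ m =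
    x∉ (subst (_∈ map proj₁ F) (⟨$⟩ˡ-injective π (trans (All.lookup forced rc∈) (sym eq))) (∈-map⁺ proj₁ rc∈))

  open-col : ∀ {R C F D OL OR π x} → State R C F D OL OR → Extends F D π → x ∉ map proj₁ F → C (π ⟨$⟩ˡ x) →
             (π ⟨$⟩ˡ x) ∈ OL ⊎ (π ⟨$⟩ˡ x) ∈ OR
  open-col {F = F} {D} {OL} {OR} {π} st pr x∉ Cx with ∈-++⁻ OL (complete (cols st) Cx)
  ... | inj₁ m = inj₁ m
  ... | inj₂ m with ∈-++⁻ OR m
  ...   | inj₁ m′ = inj₂ m′
  ...   | inj₂ m′ = contradiction m′ (fresh-col {D = D} {π} pr x∉)

  assign : ∀ {F D x c k} → HasCount (Extends ((x , c) ∷ F) D) k →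
           HasCount (λ π → Extends F D π × π ⟨$⟩ˡ x ≡ c) k
  assign = count-⇔ (λ { π (w , eq ∷ f , d) → (w , f , d) , eq }) (λ { π ((w , f , d) , eq) → w , eq ∷ f , d })

  module _ {F : Pairs} where

    -- With every row and every column in exactly one pair, `F` is the graph of a permutation, its
    -- only extension.
    count-complete : State (λ _ → ⊤) (λ _ → ⊤) F [] [] [] → HasCount (Extends F []) 1
    count-complete st = count-one σ
      ((λ i → All.lookup (allowed st) (pair-row i)) ,
       All.tabulate (λ {(r , c)} m → cong proj₂ (injRow (pair-row r) m refl)) , [])
      (λ π (_ , forced , _) i → trans (cong (π ⟨$⟩ʳ_) (sym (All.lookup forced (pair-col i)))) (inverseʳ π))
      where
      injRow = Unique-map⇒injective proj₁ (unique (rows st))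
      injCol = Unique-map⇒injective proj₂ (unique (cols st))
      colOf : ∀ r → ∃ λ c → (r , c) ∈ F
      colOf r with (_ , c) , m , refl ← ∈-map⁻ proj₁ (complete (rows st) {r} tt) = c , m
      rowOf : ∀ c → ∃ λ r → (r , c) ∈ F
      rowOf c with (r , _) , m , refl ← ∈-map⁻ proj₂ (complete (cols st) {c} tt) = r , m
      pair-row : ∀ r → (r , proj₁ (colOf r)) ∈ F
      pair-row r = proj₂ (colOf r)
      pair-col : ∀ c → (proj₁ (rowOf c) , c) ∈ F
      pair-col c = proj₂ (rowOf c)
      σ : Permutation′ n
      σ = permutation (proj₁ ∘ rowOf) (proj₁ ∘ colOf)
        (λ r → cong proj₁ (injCol (pair-col _) (pair-row r) refl))
        (λ c → cong proj₂ (injRow (pair-row _) (pair-col c) refl))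

  -- At l = r = 0 the recursion fails, 0 against 0! = 1; `balance` excludes this case while a row is
  -- deferred.
  finalCount-step : ∀ l r → r * finalCount l (pred r) ≡ finalCount l r ⊎ l ≡ 0 × r ≡ 0
  finalCount-step zero    zero    = inj₂ (refl , refl)
  finalCount-step (suc l) zero    = inj₁ refl
  finalCount-step zero    (suc r) = inj₁ refl
  finalCount-step (suc l) (suc r) = inj₁ (*-zeroʳ (suc r))

  -- A deferred row is a bottom row, to which every right column is allowed. If a left column is
  -- open, `balance` makes the deferred rows outnumber the open right columns.
  count-deferred : ∀ D {F OL OR} → State (λ _ → ⊤) (λ _ → ⊤) F D OL OR →
                   HasCount (Extends F D) (finalCount (length OL) (length OR))
  count-deferred [] {OL = []} {[]} st = count-complete st
  count-deferred [] {OL = []} {_ ∷ _} st with () ← balance st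
  count-deferred [] {OL = _ ∷ _} st with () ← balance st
  count-deferred (d ∷ D) {F} {OL} {OR} st with finalCount-step (length OL) (length OR)
  ... | inj₂ (l≡0 , r≡0) with () ← trans (balance st) (cong₂ _+_ l≡0 r≡0)
  ... | inj₁ eq = subst (HasCount _) eq (count-⇔ {P = λ π → Extends F (d ∷ D) π × (π ⟨$⟩ˡ d) ∈ OR}
        (λ π → proj₁)
        (λ π pr → pr , inOR π pr)
        (count-choose d OR (Unique-++ˡ OR (Unique-++ʳ OL (unique (cols st)))) pick))
    where
    d∉ : d ∉ map proj₁ F
    d∉ m with d≢ ∷ _ ← unique (rows st) = All.lookup d≢ (∈-++⁺ʳ D m) refl
    inOR : ∀ π → Extends F (d ∷ D) π → (π ⟨$⟩ˡ d) ∈ OR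
    inOR π pr@(_ , _ , p≤ ∷ _) with open-col {π = π} st pr d∉ tt
    ... | inj₁ m = contradiction (All.lookup (left st) m) (≤⇒≯ p≤)
    ... | inj₂ m = m
    pick : ∀ c → c ∈ OR → HasCount (λ π → Extends F (d ∷ D) π × π ⟨$⟩ˡ d ≡ c)
           (finalCount (length OL) (pred (length OR)))
    pick c m with OR′ , sp ← ∈-split m = subst (HasCount _)
      (cong (finalCount (length OL)) (sym (cong pred (↭-length sp))))
      (count-⇔
        (λ { π (w , eq ∷ f , ds) → (w , f , subst (λ c → p ≤ toℕ c) (sym eq) p≤c ∷ ds) , eq })
        (λ { π ((w , f , _ ∷ ds) , eq) → w , eq ∷ f , ds })
        (count-deferred D st′))
      where
      p≤c : p ≤ toℕ c
      p≤c = All.lookup (right st) m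
      q≤d : q ≤ toℕ d
      q≤d = All.head (bottom st)
      st′ : State (λ _ → ⊤) (λ _ → ⊤) ((d , c) ∷ F) D OL OR′
      st′ = state
        (enum-resp-↭ (++⁺ˡ OL (move _ sp)) (cols st))
        (enum-resp-↭ (↭-sym (shift d D _)) (rows st))
        (allowed⁺ {d} {c} (<⇒≤ (<-≤-trans (toℕ<n d) (+-monoˡ-≤ q p≤c)))
           (<-≤-trans (toℕ<n c) (+-monoʳ-≤ p q≤d)) ∷ allowed st)
        (left st) (All.tail (All-resp-↭ sp (right st))) (All.tail (bottom st))
        (suc-injective (trans (balance st) (trans (cong (length OL +_) (↭-length sp)) (+-suc (length OL) _))))

  -- What has been introduced after `s` top rows, or with `i` bottom rows to come. These are the
  -- staircases: `ColsTop s` holds the columns allowed to row s, `ColsBottom i` the left columns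
  -- allowed to row q+i.
  RowsTop ColsTop RowsBottom ColsBottom : ℕ → Fin n → Set
  RowsTop s r = q ≤ toℕ r ⊎ toℕ r < s
  ColsTop s c = toℕ c < p + s
  RowsBottom i r = q + i ≤ toℕ r
  ColsBottom i c = i ≤ toℕ c × toℕ c < p

  -- Row s may take any open column, left or right; column p+s is introduced only afterwards, for
  -- the later rows.
  count-top : ∀ t s {F D OL OR} → s + t ≡ q → State (RowsTop s) (ColsTop s) F D OL OR →
              HasCount (Extends F D) (topCount t (length OL) (length OR))
  count-top zero s {D = D} eq st = count-deferred D record
    { State st
    ; cols = enum-resp-⇔ _ (λ {c} _ → subst (toℕ c <_) (cong (p +_) (sym s≡q)) (toℕ<n c)) (cols st)
    ; rows = enum-resp-⇔ _ (λ {r} _ → every r) (rows st) }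
    where
    s≡q : s ≡ q
    s≡q = trans (sym (+-identityʳ s)) eq
    every : ∀ r → RowsTop s r
    every r with q ≤? toℕ r
    ... | yes le = inj₁ le
    ... | no ≰ = inj₂ (subst (toℕ r <_) (sym s≡q) (≰⇒> ≰))
  count-top (suc t) s {F} {D} {OL} {OR} eq st = count-⇔
    (λ { π (inj₁ (pr , _)) → pr ; π (inj₂ (pr , _)) → pr })
    split
    (count-⊎ {P = λ π → Extends F D π × (π ⟨$⟩ˡ x) ∈ OL} {Q = λ π → Extends F D π × (π ⟨$⟩ˡ x) ∈ OR}
      (λ { {π} {σ} (_ , l) (_ , r) π≈σ → <⇒≱ (All.lookup (left st) l)
             (subst (λ c → p ≤ toℕ c) (sym (≈⇒≡ˡ {π = π} {σ} π≈σ x)) (All.lookup (right st) r)) })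
      (count-choose x OL (Unique-++ˡ OL (unique (cols st))) pickL)
      (count-choose x OR (Unique-++ˡ OR (Unique-++ʳ OL (unique (cols st)))) pickR))
    where
    s<q : s < q
    s<q = ≤-trans (s≤s (m≤m+n s t)) (≤-reflexive (trans (sym (+-suc s t)) eq))
    eq′ : suc s + t ≡ q
    eq′ = trans (sym (+-suc s t)) eq
    s<n : s < n
    s<n = <-≤-trans s<q (m≤n+m q p)
    ps<n : p + s < n
    ps<n = +-monoʳ-< p s<q
    x y : Fin n
    x = fromℕ< s<n
    y = fromℕ< ps<n
    toℕ-x : toℕ x ≡ s
    toℕ-x = toℕ-fromℕ< s<n
    toℕ-y : toℕ y ≡ p + s
    toℕ-y = toℕ-fromℕ< ps<n
    x∉R : ¬ RowsTop s x
    x∉R (inj₁ le) = <⇒≱ s<q (subst (q ≤_) toℕ-x le)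
    x∉R (inj₂ lt) = <-irrefl toℕ-x lt
    x∉ : x ∉ map proj₁ F
    x∉ m = x∉R (sound (rows st) (∈-++⁺ʳ D m))
    split : ∀ π → Extends F D π → (Extends F D π × (π ⟨$⟩ˡ x) ∈ OL) ⊎ (Extends F D π × (π ⟨$⟩ˡ x) ∈ OR)
    split π pr@(w , _) with open-col {π = π} st pr x∉
      (subst (λ s → toℕ (π ⟨$⟩ˡ x) < p + s) toℕ-x (allowed⇒< {x} (w x)))
    ... | inj₁ m = inj₁ (pr , m)
    ... | inj₂ m = inj₂ (pr , m)
    rows′ : Enum (RowsTop (suc s)) (D ++ x ∷ map proj₁ F)
    rows′ = enum-resp-↭ (↭-sym (shift x D _)) (enum-∷ x∉R (inj₂ (s≤s (≤-reflexive toℕ-x)))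
      (λ { (inj₁ le) → inj₁ le ; (inj₂ lt) → inj₂ (m<n⇒m<1+n lt) })
      (λ { (inj₁ le) → inj₂ (inj₁ le) ; {c} (inj₂ lt) → new lt (m≤n⇒m<n∨m≡n (s≤s⁻¹ lt)) })
      (rows st))
      where
      new : ∀ {c} → toℕ c < suc s → toℕ c < s ⊎ toℕ c ≡ s → c ≡ x ⊎ RowsTop s c
      new _ (inj₁ lt) = inj₂ (inj₂ lt)
      new _ (inj₂ e) = inj₁ (toℕ-injective (trans e (sym toℕ-x)))
    cols′ : ∀ {xs} → Enum (ColsTop s) xs → Enum (ColsTop (suc s)) (y ∷ xs)
    cols′ = enum-∷ (<-irrefl toℕ-y)
      (≤-reflexive (trans (cong suc toℕ-y) (sym (+-suc p s))))
      (λ {c} lt → <-≤-trans lt (+-monoʳ-≤ p (n≤1+n s)))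
      (λ {c} lt → new (m≤n⇒m<n∨m≡n (s≤s⁻¹ (subst (toℕ c <_) (+-suc p s) lt))))
      where
      new : ∀ {c} → toℕ c < p + s ⊎ toℕ c ≡ p + s → c ≡ y ⊎ ColsTop s c
      new (inj₁ lt) = inj₂ lt
      new (inj₂ e) = inj₁ (toℕ-injective (trans e (sym toℕ-y)))
    allowed-x : ∀ {c} → ColsTop s c → Allowed x c
    allowed-x {c} lt = allowed⁺ {x} {c}
      (subst (_≤ toℕ c + q) (sym toℕ-x) (≤-trans (<⇒≤ s<q) (m≤n+m q (toℕ c))))
      (subst (λ s → toℕ c < p + s) (sym toℕ-x) lt)
    right′ : p ≤ toℕ y
    right′ = ≤-trans (m≤m+n p s) (≤-reflexive (sym toℕ-y))
    pickL : ∀ c → c ∈ OL → HasCount (λ π → Extends F D π × π ⟨$⟩ˡ x ≡ c)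
            (topCount t (pred (length OL)) (suc (length OR)))
    pickL c m with OL′ , sp ← ∈-split m =
      subst (HasCount _) (cong (λ l → topCount t l (suc (length OR))) (sym (cong pred (↭-length sp))))
        (assign (count-top t (suc s) {OL = OL′} {OR = y ∷ OR} eq′ (state
          (enum-resp-↭ (↭-trans (prep y (↭-trans (move _ sp) (++⁺ˡ OL′ (↭-sym (shift c OR _)))))
                          (↭-sym (shift y OL′ _))) (cols′ (cols st)))
          rows′
          (allowed-x (sound (cols st) (∈-++⁺ˡ m)) ∷ allowed st)
          (All.tail (All-resp-↭ sp (left st))) (right′ ∷ right st) (bottom st)
          (trans (balance st) (trans (cong (_+ length OR) (↭-length sp)) (sym (+-suc _ (length OR))))))))
    pickR : ∀ c → c ∈ OR → HasCount (λ π → Extends F D π × π ⟨$⟩ˡ x ≡ c) (topCount t (length OL) (length OR))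
    pickR c m with OR′ , sp ← ∈-split m =
      subst (HasCount _) (cong (topCount t (length OL)) (sym (↭-length sp)))
        (assign (count-top t (suc s) {OL = OL} {OR = y ∷ OR′} eq′ (state
          (enum-resp-↭ (↭-trans (prep y (++⁺ˡ OL (move _ sp))) (↭-sym (shift y OL _))) (cols′ (cols st)))
          rows′
          (allowed-x (sound (cols st) (∈-++⁺ʳ OL (∈-++⁺ˡ m))) ∷ allowed st)
          (left st) (right′ ∷ All.tail (All-resp-↭ sp (right st))) (bottom st)
          (trans (balance st) (cong (length OL +_) (↭-length sp))))))

  -- Column a is introduced before row q+a chooses, since that row may already use it.
  count-bottom : ∀ i {F D O} → i ≤ p → State (RowsBottom i) (ColsBottom i) F D O [] →
                 HasCount (Extends F D) (bottomCount (λ m → topCount q m 0) i (length O))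
  count-bottom zero _ st = count-top q 0 refl record
    { State st
    ; cols = enum-resp-⇔ (λ {c} (_ , lt) → subst (toℕ c <_) (sym (+-identityʳ p)) lt)
                         (λ {c} lt → z≤n , subst (toℕ c <_) (+-identityʳ p) lt) (cols st)
    ; rows = enum-resp-⇔ (λ {r} le → inj₁ (subst (_≤ toℕ r) (+-identityʳ q) le))
                         (λ { {r} (inj₁ le) → subst (_≤ toℕ r) (sym (+-identityʳ q)) le }) (rows st) }
  count-bottom (suc a) {F} {D} {O} a<p st = count-⇔
    (λ { π (inj₁ (pr , _)) → pr ; π (inj₂ (w , f , _ ∷ ds)) → w , f , ds })
    split
    (count-⊎ {P = λ π → Extends F D π × (π ⟨$⟩ˡ x) ∈ y ∷ O} {Q = Extends F (x ∷ D)}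
      (λ { {π} {σ} (_ , l) (_ , _ , p≤ ∷ _) π≈σ → <⇒≱ (All.lookup left′ l)
             (subst (λ c → p ≤ toℕ c) (sym (≈⇒≡ˡ {π = π} {σ} π≈σ x)) p≤) })
      (count-choose x (y ∷ O) (Unique-++ˡ (y ∷ O) (unique cols′)) pick)
      (count-bottom a (<⇒≤ a<p) (state
        cols′ rows′ (allowed st) left′ [] (q≤x ∷ bottom st) (cong suc (balance st)))))
    where
    qa<n : q + a < n
    qa<n = subst (q + a <_) (+-comm q p) (+-monoʳ-< q a<p)
    a<n : a < n
    a<n = <-≤-trans a<p (m≤m+n p q)
    x y : Fin n
    x = fromℕ< qa<n
    y = fromℕ< a<n
    toℕ-x : toℕ x ≡ q + a
    toℕ-x = toℕ-fromℕ< qa<n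
    toℕ-y : toℕ y ≡ a
    toℕ-y = toℕ-fromℕ< a<n
    q≤x : q ≤ toℕ x
    q≤x = ≤-trans (m≤m+n q a) (≤-reflexive (sym toℕ-x))
    left′ : All (λ c → toℕ c < p) (y ∷ O)
    left′ = subst (_< p) (sym toℕ-y) a<p ∷ left st
    x∉R : ¬ RowsBottom (suc a) x
    x∉R le = <-irrefl (sym toℕ-x) (subst (_≤ toℕ x) (+-suc q a) le)
    x∉ : x ∉ map proj₁ F
    x∉ m = x∉R (sound (rows st) (∈-++⁺ʳ D m))
    rows′ : Enum (RowsBottom a) (x ∷ D ++ map proj₁ F)
    rows′ = enum-∷ x∉R (≤-reflexive (sym toℕ-x)) (λ le → ≤-trans (+-monoʳ-≤ q (n≤1+n a)) le)
      (λ le → new (m≤n⇒m<n∨m≡n le)) (rows st)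
      where
      new : ∀ {c} → q + a < toℕ c ⊎ q + a ≡ toℕ c → c ≡ x ⊎ RowsBottom (suc a) c
      new {c} (inj₁ lt) = inj₂ (subst (_≤ toℕ c) (sym (+-suc q a)) lt)
      new (inj₂ e) = inj₁ (toℕ-injective (trans (sym e) (sym toℕ-x)))
    cols′ : Enum (ColsBottom a) (y ∷ O ++ map proj₂ F)
    cols′ = enum-∷ (λ (lt , _) → <-irrefl (sym toℕ-y) lt)
      (≤-reflexive (sym toℕ-y) , subst (_< p) (sym toℕ-y) a<p)
      (λ (lt , c<p) → <⇒≤ lt , c<p)
      (λ (le , c<p) → new c<p (m≤n⇒m<n∨m≡n le)) (cols st)
      where
      new : ∀ {c} → toℕ c < p → a < toℕ c ⊎ a ≡ toℕ c → c ≡ y ⊎ ColsBottom (suc a) c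
      new c<p (inj₁ lt) = inj₂ (lt , c<p)
      new _ (inj₂ e) = inj₁ (toℕ-injective (trans (sym e) (sym toℕ-y)))
    a≤ : ∀ {c} → Allowed x c → a ≤ toℕ c
    a≤ {c} al = +-cancelˡ-≤ q _ _ (subst₂ _≤_ toℕ-x (+-comm (toℕ c) q) (allowed⇒≤ {x} {c} al))
    split : ∀ π → Extends F D π → (Extends F D π × (π ⟨$⟩ˡ x) ∈ y ∷ O) ⊎ Extends F (x ∷ D) π
    split π pr@(w , f , ds) with p ≤? toℕ (π ⟨$⟩ˡ x)
    ... | yes p≤ = inj₂ (w , f , p≤ ∷ ds)
    ... | no p≰ with ∈-++⁻ (y ∷ O) (complete cols′ (a≤ (w x) , ≰⇒> p≰))
    ...   | inj₁ m = inj₁ (pr , m)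
    ...   | inj₂ m = contradiction m (fresh-col {D = D} {π} pr x∉)
    pick : ∀ c → c ∈ y ∷ O → HasCount (λ π → Extends F D π × π ⟨$⟩ˡ x ≡ c)
           (bottomCount (λ m → topCount q m 0) a (length O))
    pick c m with O′ , sp ← ∈-split m =
      subst (HasCount _) (cong (bottomCount _ a) (sym (suc-injective (↭-length sp))))
        (assign (count-bottom a {O = O′} (<⇒≤ a<p) (state
          (enum-resp-↭ (move _ sp) cols′)
          (enum-resp-↭ (↭-sym (shift x D _)) rows′)
          (allowed-c ∷ allowed st)
          (All.tail (All-resp-↭ sp left′)) [] (bottom st)
          (trans (balance st) (cong (_+ 0) (suc-injective (↭-length sp)))))))
      where
      allowed-c : Allowed x c
      allowed-c = allowed⁺ {x} {c}
        (subst₂ _≤_ (sym toℕ-x) (+-comm q (toℕ c)) (+-monoʳ-≤ q (proj₁ (sound cols′ (∈-++⁺ˡ m)))))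
        (<-≤-trans (All.lookup left′ m) (m≤m+n p (toℕ x)))

  count-Window : HasCount (Window n p) (bottomCount (λ m → topCount q m 0) p 0)
  count-Window = count-⇔ (λ { π (w , _) → w }) (λ π w → w , [] , [])
    (count-bottom p {F = []} {D = []} {O = []} ≤-refl (state
      (enum [] (λ ()) (λ (p≤ , <p) → contradiction <p (≤⇒≯ p≤)))
      (enum [] (λ ()) (λ {r} le → contradiction (toℕ<n r) (≤⇒≯ (subst (_≤ toℕ r) (+-comm q p) le))))
      [] [] [] [] refl))

-- The resulting numbers

-- cover t l r is the number of maps from t points to l + r slots that hit the first l slots.
cover : ℕ → ℕ → ℕ → ℕ
cover zero    zero    r = 1
cover zero    (suc l) r = 0
cover (suc t) l       r = l * cover t (pred l) (suc r) + r * cover t l r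

-- Taking a left column trades it for a right one, so l+r is constant and (l+r)! passes through the
-- recursion.
topCount-cover : ∀ t l r → topCount t l r ≡ (l + r) ! * cover t l r
topCount-cover zero zero r = sym (*-identityʳ (r !))
topCount-cover zero (suc l) r = sym (*-zeroʳ ((suc l + r) !))
topCount-cover (suc t) zero r = trans (cong (r *_) (topCount-cover t zero r)) (swap r (r !) _)
  where
  swap : ∀ a b c → a * (b * c) ≡ b * (a * c)
  swap = solve-∀
topCount-cover (suc t) (suc l) r = trans
  (cong₂ (λ a b → suc l * a + r * b)
    (trans (topCount-cover t l (suc r)) (cong (λ k → k ! * cover t l (suc r)) (+-suc l r)))
    (topCount-cover t (suc l) r))
  (factor (suc l) r ((suc l + r) !) _ _)
  where
  factor : ∀ a b f c d → a * (f * c) + b * (f * d) ≡ f * (a * c + b * d)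
  factor = solve-∀

-- One of the r+1 unconstrained slots is either hit or avoided.
cover-split : ∀ t l r → cover t l (suc r) ≡ cover t (suc l) r + cover t l r
cover-split zero zero r = refl
cover-split zero (suc l) r = refl
cover-split (suc t) zero r rewrite cover-split t zero r = ring r (cover t 1 r) (cover t 0 r)
  where
  ring : ∀ r x y → suc r * (x + y) ≡ 1 * (x + y) + r * x + r * y
  ring = solve-∀
cover-split (suc t) (suc l) r
  rewrite cover-split t l (suc r) | cover-split t (suc l) r
  = ring l r (cover t (2 + l) r) (cover t (suc l) r) (cover t l (suc r))
  where
  ring : ∀ l r x y z → suc l * ((x + y) + z) + suc r * (x + y)
                     ≡ ((2 + l) * (x + y) + r * x) + (suc l * z + r * y)
  ring = solve-∀

-- With r = 0, `cover` counts surjections.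
cover-S2 : ∀ t m → cover t m 0 ≡ m ! * S2 t m
cover-S2 zero zero = refl
cover-S2 zero (suc m) = sym (*-zeroʳ (suc m !))
cover-S2 (suc t) zero = refl
cover-S2 (suc t) (suc m)
  rewrite cover-split t m 0 | cover-S2 t (suc m) | cover-S2 t m
  = ring m (m !) (S2 t (suc m)) (S2 t m)
  where
  ring : ∀ m f x y → suc m * (suc m * f * x + f * y) + 0 ≡ suc m * f * (suc m * x + y)
  ring = solve-∀

topCount-S2 : ∀ q m → topCount q m 0 ≡ m ! * (m ! * S2 q m)
topCount-S2 q m = trans (topCount-cover q m 0) (cong₂ (λ k c → k ! * c) (+-identityʳ m) (cover-S2 q m))

S2-vanish : ∀ {n k} → n < k → S2 n k ≡ 0
S2-vanish {zero} {suc k} _ = refl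
S2-vanish {suc n} {suc k} (s≤s lt) rewrite S2-vanish {n} {suc k} (m<n⇒m<1+n lt) | S2-vanish lt =
  cong (_+ 0) (*-zeroʳ k)

-- Finite sums and the Stirling expansion

sumTo : (ℕ → ℕ) → ℕ → ℕ
sumTo f n = sum (applyUpTo f n)

sumTo-cong : ∀ {f g} n → (∀ m → f m ≡ g m) → sumTo f n ≡ sumTo g n
sumTo-cong zero    eq = refl
sumTo-cong (suc n) eq = cong₂ _+_ (eq 0) (sumTo-cong n (eq ∘ suc))

sumTo-+ : ∀ f g n → sumTo (λ m → f m + g m) n ≡ sumTo f n + sumTo g n
sumTo-+ f g zero    = refl
sumTo-+ f g (suc n) = trans (cong (f 0 + g 0 +_) (sumTo-+ (f ∘ suc) (g ∘ suc) n))
  (interchange (f 0) (g 0) _ _)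
  where
  interchange : ∀ a b c d → a + b + (c + d) ≡ a + c + (b + d)
  interchange = solve-∀

sumTo-last : ∀ f n → f n ≡ 0 → sumTo f (suc n) ≡ sumTo f n
sumTo-last f zero    eq = trans (+-identityʳ _) eq
sumTo-last f (suc n) eq = cong (f 0 +_) (sumTo-last (f ∘ suc) n eq)

sumTo-zero : ∀ f n → (∀ m → f m ≡ 0) → sumTo f n ≡ 0
sumTo-zero f zero    z = refl
sumTo-zero f (suc n) z = cong₂ _+_ (z 0) (sumTo-zero (f ∘ suc) n (z ∘ suc))

sumTo-min : ∀ f p q → (∀ m → q < m → f m ≡ 0) → sumTo f (suc p) ≡ sumTo f (suc (min p q))
sumTo-min f zero    q       _ = refl
sumTo-min f (suc p) zero    z = cong (f 0 +_) (sumTo-zero (f ∘ suc) (suc p) (λ m → z (suc m) (s≤s z≤n)))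
sumTo-min f (suc p) (suc q) z = cong (f 0 +_) (sumTo-min (f ∘ suc) p q (λ m lt → z (suc m) (s≤s lt)))

shifted : (ℕ → ℕ) → ℕ → ℕ
shifted g k = suc k * g k + g (suc k)

-- `bottomCount` iterates the operator `shifted`, so its outermost application can be moved to the
-- innermost place.
bottomCount-shifted : ∀ g i k → bottomCount g (suc i) k ≡ bottomCount (shifted g) i k
bottomCount-shifted g zero    k = refl
bottomCount-shifted g (suc i) k =
  cong₂ (λ a b → suc k * a + b) (bottomCount-shifted g i k) (bottomCount-shifted g i (suc k))

bottomCount-S2 : ∀ g p → bottomCount g p 0 ≡ sumTo (λ m → S2 (suc p) (suc m) * g m) (suc p)
bottomCount-S2 g zero = sym (trans (+-identityʳ _) (+-identityʳ (g 0)))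
bottomCount-S2 g (suc p) = begin
  bottomCount g (suc p) 0
    ≡⟨ bottomCount-shifted g p 0 ⟩
  bottomCount (shifted g) p 0
    ≡⟨ bottomCount-S2 (shifted g) p ⟩
  sumTo (λ m → S2 (suc p) (suc m) * shifted g m) (suc p)
    ≡⟨ sumTo-cong (suc p) (λ m → ring₁ m (S2 (suc p) (suc m)) (g m) (g (suc m))) ⟩
  sumTo (λ m → low m + high (suc m)) (suc p)
    ≡⟨ sumTo-+ low (high ∘ suc) (suc p) ⟩
  sumTo low (suc p) + sumTo (high ∘ suc) (suc p)
    -- Both sums reach length p+2 by a zero term: `high 0` computes to 0, and `low (suc p)` contains
    -- S(p+1, p+2).
    ≡⟨ cong (_+ sumTo high (2 + p)) (sym (sumTo-last low (suc p) low-last)) ⟩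
  sumTo low (2 + p) + sumTo high (2 + p)
    ≡⟨ sym (sumTo-+ low high (2 + p)) ⟩
  sumTo (λ m → low m + high m) (2 + p)
    ≡⟨ sumTo-cong (2 + p) (λ m → ring₂ m (S2 (suc p) (suc m)) (S2 (suc p) m) (g m)) ⟩
  sumTo (λ m → S2 (2 + p) (suc m) * g m) (2 + p) ∎
  where
  open ≡-Reasoning
  low high : ℕ → ℕ
  low m  = suc m * S2 (suc p) (suc m) * g m
  high m = S2 (suc p) m * g m
  low-last : low (suc p) ≡ 0
  low-last = trans (cong (λ s → suc (suc p) * s * g (suc p)) (S2-vanish {suc p} {2 + p} ≤-refl))
                   (cong (_* g (suc p)) (*-zeroʳ (2 + p)))
  ring₁ : ∀ m s a b → s * (suc m * a + b) ≡ suc m * s * a + s * b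
  ring₁ = solve-∀
  ring₂ : ∀ m s s′ a → suc m * s * a + s′ * a ≡ (suc m * s + s′) * a
  ring₂ = solve-∀

count≡polyBernoulliC : ∀ p q → bottomCount (λ m → topCount q m 0) p 0 ≡ polyBernoulliC p q
count≡polyBernoulliC p q = begin
  bottomCount (λ m → topCount q m 0) p 0
    ≡⟨ bottomCount-S2 (λ m → topCount q m 0) p ⟩
  sumTo (λ m → S2 (suc p) (suc m) * topCount q m 0) (suc p)
    ≡⟨ sumTo-cong (suc p) (λ m → trans (cong (S2 (suc p) (suc m) *_) (topCount-S2 q m))
         (ring (S2 (suc p) (suc m)) (m !) (S2 q m))) ⟩
  sumTo term (suc p)
    ≡⟨ sumTo-min term p q (λ m q<m → trans (cong (m ! * m ! * S2 (suc p) (suc m) *_) (S2-vanish q<m))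
         (*-zeroʳ (m ! * m ! * S2 (suc p) (suc m)))) ⟩
  sumTo term (suc (min p q))
    ≡⟨ cong sum (sym (map-upTo term (suc (min p q)))) ⟩
  polyBernoulliC p q ∎
  where
  open ≡-Reasoning
  term : ℕ → ℕ
  term m = m ! * m ! * S2 (suc p) (suc m) * S2 q m
  ring : ∀ s f s′ → s * (f * (f * s′)) ≡ f * f * s * s′
  ring = solve-∀

theorem2p8 : ∀ (n p : ℕ) → 1 ≤ n → 1 ≤ p → p ≤ n →
    (∀ (π : Permutation′ n) → InAllT n p π ⇔ Window n p π)
    × HasCount (InAllT n p) (polyBernoulliC p (n ∸ p))
theorem2p8 n p _ 1≤p p≤n with q , refl ← m≤n⇒∃[o]m+o≡n p≤n rewrite m+n∸m≡n p q =
  InAllT⇔Window p 1≤p p≤n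
  , count-⇔ (λ π → Equivalence.from (InAllT⇔Window p 1≤p p≤n π))
            (λ π → Equivalence.to (InAllT⇔Window p 1≤p p≤n π))
      (subst (HasCount (Window (p + q) p)) (count≡polyBernoulliC p q) (Matching.count-Window p q))
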